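{- The total auxiliary space usage of NFS Sort (the algorithm specified in the context, with its implementation constants fixed independently of the input) on an input array of $n$ finite numeric values is $\mathcal{O}(\log n)$ in the worst case.
   Context: NFS Sort is a sequential sorting algorithm for an array of $n$ finite numbers of a fixed-size type (no NaN or infinities). Fixed implementation constants, independent of $n$ and of the input: a cleanup bound $S\ge 1$; a progress constant $\alpha$ with $0<\alpha<1$; a nonnegative integer $c$ (the number of consecutive pathological recursive steps permitted); a maximal number of buckets $K_{\max}$ (equal to $6500$ in the implementation); a fixed fragment size. Top level. The algorithm returns at once if the array is sorted, and reverses it and returns if it is reverse sorted. Otherwise it determines bounds $\min<\max$ for the values (possibly approximate, in which case the first scatter step uses two additional buckets for elements below and above the bounds and computes the true minimum and maximum), and calls the recursive core procedure on the whole array with pathological counter $0$. After the recursion has terminated, it runs insertion sort once on the entire array. Recursive core procedure, on a contiguous subarray of size $m$ whose elements lie in a given interval $[\mathit{min},\mathit{max}]$, with a given pathological counter: 1. (Except in the initial call) if all elements of the subarray are equal, return. 2. Choose a number of buckets $k\le K_{\max}$ depending only on $m$ (plus possibly two additional buckets in the initial call). 3. Scatter step: each element $x$ is assigned to the bucket with index $b(x)=\left\lfloor \frac{(x-\mathit{min})(k-1)}{\mathit{max}-\mathit{min}}\right\rfloor$, and the subarray is permuted so that each bucket occupies a contiguous region, the regions appearing in increasing order of bucket index. The step returns a vector of bucket offsets, local to this recursive call, containing $k+1$ integers (at most $K_{\max}+3$ in the initial call). 4. For each bucket $i$, of size $m_i$: if $m_i\le S$, it is left unchanged. If $m_i>S$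 and $m_i\le\alpha m$ (non-pathological), the core procedure is called on the bucket with the pathological counter reset to $0$. If $m_i>S$ and $m_i>\alpha m$ (pathological), then: if the current pathological counter is less than $c$, the core procedure is called on the bucket with the counter increased by $1$; otherwise the bucket is sorted by a fallback comparison sort and no recursion takes place inside it. In recursive calls the bounds passed are $\mathit{min}+i\cdot w$ and $\mathit{min}+(i+1)\cdot w$, with $w=\frac{\mathit{max}-\mathit{min}}{k-1}$. Auxiliary space (number of machine words) consists of: the work arrays allocated once at top level and reused throughout the recursion (helper array, fragment buffers, bucket-size, fragment-size and offset arrays), whose total size is a constant independent of $n$; and the bucket-offset vectors of all recursive calls simultaneously live on the call stack (a call's vector is destroyed when the call returns), together with constant-size stack frames. The space usage is the maximum over the execution of this quantity.
   Formalization: The progress constant α and the array values are taken to be rational numbers (with exact arithmetic) rather than real numbers. -}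

module Defs where

open import Data.Fin.Base using (Fin; zero; suc; toℕ; inject₁)
open import Data.Integer.Base as ℤ using (ℤ; +_)
import Data.Integer.Properties as ℤ
open import Data.List.Base
  using (List; []; _∷_; _++_; length; map; concatMap; filter; take; drop; reverse; foldr; allFin)
open import Data.List.Extrema.Nat using (max)
open import Data.List.Properties using (length-take; length-drop)
open import Data.List.Relation.Binary.Permutation.Propositional using (_↭_)
open import Data.List.Relation.Binary.Permutation.Propositional.Properties using (↭-length)
open import Data.List.Relation.Unary.All using (All)
open import Data.List.Relation.Unary.AllPairs using (AllPairs; allPairs?)
open import Data.Nat.Base as ℕ
  using (ℕ; zero; suc; _+_; _*_; _∸_; _≤_; _<_; s≤s)
import Data.Nat.Properties as ℕ
open import Data.Nat.Induction using (<-wellFounded)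
open import Data.Product.Base using (_×_; _,_; Σ-syntax; proj₁; proj₂)
open import Data.Rational.Base as ℚ using (ℚ; 0ℚ; 1ℚ; ≢-nonZero)
import Data.Rational.Properties as ℚ
import Data.Rational.Unnormalised.Base as ℚᵘ
import Data.Rational.Unnormalised.Properties as ℚᵘ
open import Data.Vec.Base as Vec using (Vec)
open import Function.Base using (_on_)
open import Induction.WellFounded using (Acc; acc)
open import Relation.Binary.Bundles using (DecTotalOrder)
open import Relation.Binary.PropositionalEquality.Core using (subst₂)
open import Relation.Nullary.Decidable.Core using (yes; no)

open import Data.List.Relation.Unary.Sorted.TotalOrder (DecTotalOrder.totalOrder ℚ.≤-decTotalOrder) using (sorted?)
open import Data.List.Sort.Base (DecTotalOrder.totalOrder ℚ.≤-decTotalOrder) using (SortingAlgorithm)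
import Data.List.Sort.InsertionSort ℚ.≤-decTotalOrder as InsertionSort

------------------------------------------------------------------------
-- Finite machine numbers are modelled as rationals, with exact arithmetic.

Array : Set
Array = List ℚ

fromℕ : ℕ → ℚ
fromℕ m = + m ℚ./ 1

-- Division made total by p ÷₀ 0 = 0.  In an execution of the algorithm the
-- divisors are max - min > 0 and k - 1 ≥ 1.
_÷₀_ : ℚ → ℚ → ℚ
p ÷₀ q with q ℚ.≟ 0ℚ
... | yes _   = 0ℚ
... | no  q≢0 = (p ℚ.÷ q) {{≢-nonZero q≢0}}

record Interval : Set where
  constructor ⟦_,_⟧
  field
    lo hi : ℚ

_∈ᴵ_ : ℚ → Interval → Set
x ∈ᴵ ⟦ lo , hi ⟧ = lo ℚ.≤ x × x ℚ.≤ hi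

------------------------------------------------------------------------
-- Everything here is fixed once and for all, independently of the input.

record Implementation : Set where
  field
    -- cleanup bound
    S         : ℕ
    1≤S       : 1 ≤ S
    -- progress constant
    α         : ℚ
    0<α       : 0ℚ ℚ.< α
    α<1       : α ℚ.< 1ℚ
    -- consecutive pathological steps permitted
    c         : ℕ
    -- number of buckets, as a function of the size of the subarray; at least
    -- two, since the bucket index and the bucket width divide by k - 1
    Kmax      : ℕ
    k         : ℕ → ℕ
    2≤k       : ∀ m → 2 ≤ k m
    k≤Kmax    : ∀ m → k m ≤ Kmax
    fallback  : SortingAlgorithm
    -- sizes, in machine words unless stated otherwise
    frameWords       : ℕ  -- an upper bound for one stack frame
    valueWords       : ℕ  -- one number
    helperWords      : ℕ
    fragmentSize     : ℕ  -- numbers per fragment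
    fragmentBuffers  : ℕ  -- how many
    bucketSizeWords  : ℕ
    fragmentLenWords : ℕ  -- the array of fragment sizes
    offsetWords      : ℕ  -- the reused work array, not the local vectors

  workWords : ℕ
  workWords = helperWords + fragmentBuffers * (fragmentSize * valueWords)
            + bucketSizeWords + fragmentLenWords + offsetWords

------------------------------------------------------------------------
-- What the description of the algorithm leaves open in a given execution.

data InitialBounds (xs : Array) : Set where
  exact       : (I : Interval) → Interval.lo I ℚ.< Interval.hi I →
                All (_∈ᴵ I) xs → InitialBounds xs
  approximate : (I : Interval) → Interval.lo I ℚ.< Interval.hi I →
                InitialBounds xs

record Choices : Set where
  field
    initialBounds : (xs : Array) → InitialBounds xs
    -- The order of the elements inside a bucket is arbitrary.
    permute       : (b : ℚ → ℤ) (xs : Array) →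
                    Σ[ ys ∈ Array ] ys ↭ xs × AllPairs (ℤ._≤_ on b) ys

------------------------------------------------------------------------
-- How a scatter step assigns elements to buckets: bucketOf x is always one
-- of 0 , … , K - 1 for the elements x the layout is used with, and the
-- recursive call on bucket i is passed bounds i.

record Layout : Set where
  field
    K        : ℕ
    bucketOf : ℚ → ℤ
    bounds   : ℕ → Interval

regular : Interval → (k : ℕ) → Layout
regular ⟦ lo , hi ⟧ k = record
  { K        = k
  ; bucketOf = λ x → ℚ.floor (((x ℚ.- lo) ℚ.* fromℕ (k ∸ 1)) ÷₀ (hi ℚ.- lo))
  ; bounds   = λ i → ⟦ lo ℚ.+ fromℕ i ℚ.* w , lo ℚ.+ fromℕ (suc i) ℚ.* w ⟧
  }
  where
  w = (hi ℚ.- lo) ÷₀ fromℕ (k ∸ 1)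

-- The regular buckets, preceded by a bucket for the elements below the
-- approximate bounds and followed by one for the elements above them.
extended : Interval → (k : ℕ) → Array → Layout
extended I@(⟦ lo , hi ⟧) k xs = record
  { K        = 2 + k
  ; bucketOf = bucketOf′
  ; bounds   = bounds′
  }
  where
  module R = Layout (regular I k)

  -- These are the minimum and maximum of xs as soon as the corresponding
  -- additional bucket is nonempty.
  trueMin = foldr ℚ._⊓_ lo xs
  trueMax = foldr ℚ._⊔_ hi xs

  bucketOf′ : ℚ → ℤ
  bucketOf′ x with x ℚ.<? lo | hi ℚ.<? x
  ... | yes _ | _     = + 0
  ... | no  _ | yes _ = + suc k
  ... | no  _ | no  _ = + 1 ℤ.+ R.bucketOf x

  bounds′ : ℕ → Interval
  bounds′ zero = ⟦ trueMin , lo ⟧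
  bounds′ (suc i) with i ℕ.≟ k
  ... | yes _ = ⟦ hi , trueMax ⟧
  ... | no  _ = R.bounds i

------------------------------------------------------------------------
-- Offset i is the position where bucket i starts; the last one is the end.

offsetVector : (K : ℕ) → (ℚ → ℤ) → Array → Vec ℕ (suc K)
offsetVector K b ys = Vec.tabulate λ i →
  length (filter (λ x → b x ℤ.<? + toℕ i) ys)

region : ∀ {K} → Vec ℕ (suc K) → Array → Fin K → Array
region offs ys i = take (Vec.lookup offs (suc i) ∸ start) (drop start ys)
  where start = Vec.lookup offs (inject₁ i)

vectorWords : ∀ {n} → Vec ℕ n → ℕ
vectorWords {n} _ = n

------------------------------------------------------------------------
-- An executed procedure call: the resulting array contents, and the number
-- of words of auxiliary space in use at successive moments of the call,
-- covering every moment at which this number is largest.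

record Execution : Set where
  constructor _▹_
  field
    contents : Array
    usage    : List ℕ

open Execution

module NFSSort (A : Implementation) (Ch : Choices) where
  open Implementation A
  open Choices Ch

  data Action (m counter mᵢ : ℕ) : Set where
    leave     : mᵢ ≤ S → Action m counter mᵢ
    recurse   : S < mᵢ → fromℕ mᵢ ℚ.≤ α ℚ.* fromℕ m →
                Action m counter mᵢ
    recurse⁺  : S < mᵢ → α ℚ.* fromℕ m ℚ.< fromℕ mᵢ → counter < c →
                Action m counter mᵢ
    fall-back : S < mᵢ → α ℚ.* fromℕ m ℚ.< fromℕ mᵢ → c ≤ counter →
                Action m counter mᵢ

  action : ∀ m counter mᵢ → Action m counter mᵢ
  action m counter mᵢ with mᵢ ℕ.≤? S
  ... | yes small = leave small
  ... | no  large with fromℕ mᵢ ℚ.≤? α ℚ.* fromℕ m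
  ...   | yes nonpath = recurse (ℕ.≰⇒> large) nonpath
  ...   | no  path with counter ℕ.<? c
  ...     | yes below = recurse⁺ (ℕ.≰⇒> large) (ℚ.≰⇒> path) below
  ...     | no  full  = fall-back (ℕ.≰⇒> large) (ℚ.≰⇒> path) (ℕ.≮⇒≥ full)

  -- Termination measure of the recursion.
  measure : (m counter : ℕ) → ℕ
  measure m counter = m * suc c + (c ∸ counter)

  private
    fromℕ-cancel-< : ∀ m n → fromℕ m ℚ.< fromℕ n → m < n
    fromℕ-cancel-< m n m<n = ℤ.drop‿+<+ (subst₂ ℤ._<_
      (ℤ.*-identityʳ (+ m)) (ℤ.*-identityʳ (+ n))
      (ℚᵘ.drop-*<* (ℚᵘ.<-respʳ-≃ (ℚ.toℚᵘ-fromℚᵘ (ℚᵘ.mkℚᵘ (+ n) 0))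
        (ℚᵘ.<-respˡ-≃ (ℚ.toℚᵘ-fromℚᵘ (ℚᵘ.mkℚᵘ (+ m) 0))
          (ℚ.toℚᵘ-mono-< m<n)))))

  nonpathological-shrinks : ∀ {m mᵢ} → S < mᵢ → mᵢ ≤ m →
                            fromℕ mᵢ ℚ.≤ α ℚ.* fromℕ m → mᵢ < m
  nonpathological-shrinks {zero}  S<mᵢ mᵢ≤m _ with () ← ℕ.<-≤-trans S<mᵢ mᵢ≤m
  nonpathological-shrinks {suc m} {mᵢ} _ _ mᵢ≤αm =
    fromℕ-cancel-< mᵢ (suc m) (ℚ.≤-<-trans mᵢ≤αm
      (ℚ.<-respʳ-≡ (ℚ.*-identityˡ (fromℕ (suc m)))
        (ℚ.*-monoˡ-<-pos (fromℕ (suc m))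
          {{ℚ.normalize-pos (suc m) 1}} α<1)))

  recurse-decreases : ∀ {m mᵢ} counter → mᵢ < m →
                      measure mᵢ 0 < measure m counter
  recurse-decreases {m} {mᵢ} counter mᵢ<m = begin-strict
    mᵢ * suc c + c            <⟨ ℕ.+-monoʳ-< (mᵢ * suc c) (ℕ.n<1+n c) ⟩
    mᵢ * suc c + suc c        ≡⟨ ℕ.+-comm (mᵢ * suc c) (suc c) ⟩
    suc mᵢ * suc c            ≤⟨ ℕ.*-monoˡ-≤ (suc c) mᵢ<m ⟩
    m * suc c                 ≤⟨ ℕ.m≤m+n (m * suc c) (c ∸ counter) ⟩
    m * suc c + (c ∸ counter) ∎
    where open ℕ.≤-Reasoning

  recurse⁺-decreases : ∀ {m mᵢ counter} → mᵢ ≤ m → counter < c →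
                       measure mᵢ (suc counter) < measure m counter
  recurse⁺-decreases mᵢ≤m counter<c =
    ℕ.+-mono-≤-< (ℕ.*-monoˡ-≤ (suc c) mᵢ≤m)
      (ℕ.∸-monoʳ-< (ℕ.n<1+n _) counter<c)

  region-length : ∀ {K} (offs : Vec ℕ (suc K)) {xs ys} (i : Fin K) →
                  ys ↭ xs → length (region offs ys i) ≤ length xs
  region-length offs {xs} {ys} i ys↭xs = begin
    length (take l (drop s ys))   ≡⟨ length-take l (drop s ys) ⟩
    l ℕ.⊓ length (drop s ys)      ≤⟨ ℕ.m⊓n≤n l _ ⟩
    length (drop s ys)            ≡⟨ length-drop s ys ⟩
    length ys ∸ s                 ≤⟨ ℕ.m∸n≤m (length ys) s ⟩
    length ys                     ≡⟨ ↭-length ys↭xs ⟩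
    length xs                     ∎
    where
    open ℕ.≤-Reasoning
    s = Vec.lookup offs (inject₁ i)
    l = Vec.lookup offs (suc i) ∸ s

  -- The argument live is the space in use: by the callers in the case of
  -- core, including the call's own frame in the case of scatterAndRecurse.
  -- Successive calls on the buckets start from the same value, as each of
  -- them has released its frame and its offset vector on returning.
  mutual
    core : (live : ℕ) → Interval → (counter : ℕ) (xs : Array) →
           Acc _<_ (measure (length xs) counter) → Execution
    core live I counter xs rec with allPairs? ℚ._≟_ xs
    ... | yes allEqual = xs ▹ (live + frameWords ∷ [])
    ... | no  _        =
      scatterAndRecurse (live + frameWords) (regular I (k (length xs))) counter xs rec

    scatterAndRecurse : (live : ℕ) → Layout → (counter : ℕ) (xs : Array) →
                        Acc _<_ (measure (length xs) counter) → Execution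
    scatterAndRecurse live L counter xs (acc rs) =
      concatMap contents calls ▹ (live′ ∷ concatMap usage calls)
      where
      open Layout L
      permuted = permute bucketOf xs
      ys       = proj₁ permuted
      offs     = offsetVector K bucketOf ys
      live′    = live + vectorWords offs

      process : (i : Fin K) → Action (length xs) counter (length (region offs ys i)) →
                Execution
      process i (leave _) = region offs ys i ▹ []
      process i (recurse S<mᵢ mᵢ≤αm) =
        core live′ (bounds (toℕ i)) 0 (region offs ys i)
          (rs (recurse-decreases counter
            (nonpathological-shrinks S<mᵢ
              (region-length offs i (proj₁ (proj₂ permuted))) mᵢ≤αm)))
      process i (recurse⁺ _ _ counter<c) =
        core live′ (bounds (toℕ i)) (suc counter) (region offs ys i)
          (rs (recurse⁺-decreases
            (region-length offs i (proj₁ (proj₂ permuted))) counter<c))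
      process i (fall-back _ _ _) =
        SortingAlgorithm.sort fallback (region offs ys i) ▹ (live′ + frameWords ∷ [])

      calls : List Execution
      calls = map (λ i → process i (action (length xs) counter (length (region offs ys i))))
                  (allFin K)

  initialLayout : (xs : Array) → InitialBounds xs → Layout
  initialLayout xs (exact I _ _)     = regular I (k (length xs))
  initialLayout xs (approximate I _) = extended I (k (length xs)) xs

  nfsSort : Array → Execution
  nfsSort xs with sorted? ℚ._≤?_ xs | sorted? ℚ._≤?_ (reverse xs)
  ... | yes _ | _     = xs ▹ (frameWords ∷ [])
  ... | no  _ | yes _ = reverse xs ▹ (frameWords ∷ [])
  ... | no  _ | no  _ =
    InsertionSort.sort (contents recursion)
      ▹ (live ∷ usage recursion ++ live + frameWords ∷ [])
    where
    live = frameWords + workWords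
    -- The initial call of the core procedure, which omits the test for equality.
    recursion = scatterAndRecurse (live + frameWords)
      (initialLayout xs (initialBounds xs)) 0 xs (<-wellFounded _)

spaceUsage : Implementation → Choices → Array → ℕ
spaceUsage A Ch xs = max 0 (usage (NFSSort.nfsSort A Ch xs))

{-# OPTIONS --safe #-}
module Submission where

-- Write α = p / q.  A call on m elements with α ^ d * m < 1 makes at most d
-- nonpathological steps down any branch, with at most c pathological ones
-- before and after each, and every level costs a bounded number of words.  By
-- Bernoulli 2 * p ^ q ≤ q ^ q, that is, q nonpathological steps halve the size, so
-- d = q * (1 + ⌊log₂ n⌋) is large enough for n elements.

open import Defs
open import Data.Fin.Base using (Fin; toℕ)
open import Data.Integer.Base as ℤ using (+_; -[1+_])
import Data.Integer.Properties as ℤ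
open import Data.List.Base using (List; []; _∷_; length; map; concatMap; allFin; reverse)
open import Data.List.Extrema.Nat using (max≤v⁺)
open import Data.List.Relation.Unary.All as All using (All; []; _∷_)
import Data.List.Relation.Unary.All.Properties as All
open import Data.List.Relation.Unary.AllPairs using (allPairs?)
open import Data.Nat.Base using (ℕ; zero; suc; _+_; _*_; _^_; _∸_; _≤_; _<_; z≤n; s≤s; s≤s⁻¹; NonZero)
open import Data.Nat.Induction using (<-wellFounded)
open import Data.Nat.Logarithm using (⌊log₂_⌋; ⌊log₂⌋-mono-≤; ⌊log₂[2^n]⌋≡n)
open import Data.Nat.Properties
open import Data.Nat.Tactic.RingSolver using (solve-∀)
open import Data.Product.Base using (∃-syntax; _,_; proj₁; proj₂)
open import Data.Rational.Base as ℚ using (mkℚ; 0ℚ; 1ℚ; ↥_; ↧ₙ_)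
import Data.Rational.Properties as ℚ
import Data.Rational.Unnormalised.Base as ℚᵘ
import Data.Rational.Unnormalised.Properties as ℚᵘ
open import Induction.WellFounded using (Acc; acc)
open import Relation.Binary.PropositionalEquality.Core using (_≡_; refl; sym; cong; subst; subst₂)
open import Relation.Binary.Bundles using (DecTotalOrder)
open import Relation.Nullary.Decidable.Core using (yes; no)
open import Data.List.Relation.Unary.Sorted.TotalOrder (DecTotalOrder.totalOrder ℚ.≤-decTotalOrder) using (sorted?)

-- Exponential inequalities and the binary logarithm.

-- Multiplied by p so that the binomial terms p ^ n + n * p ^ (n ∸ 1) need no subtraction.
bernoulli : ∀ p n → (p + n) * p ^ n ≤ p * suc p ^ n
bernoulli p zero    = ≤-reflexive (cong (_* 1) (+-identityʳ p))
bernoulli p (suc n) = begin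
  (p + suc n) * (p * p ^ n)                  ≤⟨ m≤m+n _ (n * p ^ n) ⟩
  (p + suc n) * (p * p ^ n) + n * p ^ n      ≡⟨ expand p n (p ^ n) ⟩
  suc p * ((p + n) * p ^ n)                  ≤⟨ *-monoʳ-≤ (suc p) (bernoulli p n) ⟩
  suc p * (p * suc p ^ n)                    ≡⟨ swap p (suc p ^ n) ⟩
  p * (suc p * suc p ^ n)                    ∎
  where
  open ≤-Reasoning
  expand : ∀ p n x → (p + suc n) * (p * x) + n * x ≡ suc p * ((p + n) * x)
  expand = solve-∀
  swap : ∀ p x → suc p * (p * x) ≡ p * (suc p * x)
  swap = solve-∀

-- `bernoulli` at exponent `q`, with `2 * p ≤ p + q` on the left and `suc p ≤ q` on the right; then
-- `p` cancels. For `p = 0` nothing can be cancelled, but `q` is positive and the power vanishes.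
2*p^q≤q^q : ∀ {p q} → p < q → 2 * p ^ q ≤ q ^ q
2*p^q≤q^q {zero}      {suc q} _   = z≤n
2*p^q≤q^q {p@(suc _)} {q}     p<q = *-cancelˡ-≤ p (begin
  p * (2 * p ^ q)   ≡⟨ double p (p ^ q) ⟩
  (p + p) * p ^ q   ≤⟨ *-monoˡ-≤ (p ^ q) (+-monoʳ-≤ p (<⇒≤ p<q)) ⟩
  (p + q) * p ^ q   ≤⟨ bernoulli p q ⟩
  p * suc p ^ q     ≤⟨ *-monoʳ-≤ p (^-monoˡ-≤ q p<q) ⟩
  p * q ^ q         ∎)
  where
  open ≤-Reasoning
  double : ∀ p x → p * (2 * x) ≡ (p + p) * x
  double = solve-∀

2^l*p^ql≤q^ql : ∀ {p q} l → p < q → 2 ^ l * p ^ (q * l) ≤ q ^ (q * l)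
2^l*p^ql≤q^ql {p} {q} zero    _   rewrite *-zeroʳ q = ≤-refl
2^l*p^ql≤q^ql {p} {q} (suc l) p<q
  rewrite *-suc q l | ^-distribˡ-+-* p q (q * l) | ^-distribˡ-+-* q q (q * l) = begin
  2 ^ suc l * (p ^ q * p ^ (q * l))         ≡⟨ interchange 2 (2 ^ l) (p ^ q) (p ^ (q * l)) ⟩
  2 * p ^ q * (2 ^ l * p ^ (q * l))         ≤⟨ *-mono-≤ (2*p^q≤q^q p<q) (2^l*p^ql≤q^ql l p<q) ⟩
  q ^ q * q ^ (q * l)                       ∎
  where
  open ≤-Reasoning
  interchange : ∀ a b c d → a * b * (c * d) ≡ a * c * (b * d)
  interchange = solve-∀

-- Otherwise monotonicity of the logarithm would give `suc ⌊log₂ n ⌋ ≤ ⌊log₂ n ⌋`.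
n<2^[1+⌊log₂n⌋] : ∀ n → n < 2 ^ suc ⌊log₂ n ⌋
n<2^[1+⌊log₂n⌋] n = ≰⇒> λ 2^l≤n → n≮n ⌊log₂ n ⌋
  (subst (_≤ ⌊log₂ n ⌋) (⌊log₂[2^n]⌋≡n (suc ⌊log₂ n ⌋)) (⌊log₂⌋-mono-≤ 2^l≤n))

1≤⌊log₂n⌋ : ∀ {n} → 2 ≤ n → 1 ≤ ⌊log₂ n ⌋
1≤⌊log₂n⌋ = ⌊log₂⌋-mono-≤

-- From rationals to natural numerators and denominators.

∣↥p∣<↧p : ∀ {p} → 0ℚ ℚ.< p → p ℚ.< 1ℚ → ℤ.∣ ↥ p ∣ < ↧ₙ p
∣↥p∣<↧p {mkℚ (+ n) d-1 _} _ p<1 = ℤ.drop‿+<+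
  (subst₂ ℤ._<_ (ℤ.*-identityʳ (+ n)) (ℤ.*-identityˡ (+ suc d-1)) (ℚ.drop-*<* p<1))
∣↥p∣<↧p {mkℚ -[1+ n ] _ _} 0<p _ with () ← ℚ.drop-*<* 0<p

∣↥p∣≢0 : ∀ {p} → 0ℚ ℚ.< p → NonZero ℤ.∣ ↥ p ∣
∣↥p∣≢0 {mkℚ (+ suc _) _ _}  _   = _
∣↥p∣≢0 {mkℚ (+ zero)  _ _}  0<p with ℤ.+<+ () ← ℚ.drop-*<* 0<p
∣↥p∣≢0 {mkℚ (-[1+ _ ]) _ _} _   = _

+m≤i⇒m≤∣i∣ : ∀ {m i} → + m ℤ.≤ i → m ≤ ℤ.∣ i ∣
+m≤i⇒m≤∣i∣ (ℤ.+≤+ m≤n) = m≤n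

toℚᵘ-fromℕ : ∀ m → ℚ.toℚᵘ (fromℕ m) ℚᵘ.≃ ℚᵘ.mkℚᵘ (+ m) 0
toℚᵘ-fromℕ m = ℚ.toℚᵘ-fromℚᵘ (ℚᵘ.mkℚᵘ (+ m) 0)

-- Cross-multiplication, done on unnormalised rationals, where the product has not been reduced to
-- lowest terms.
fromℕ≤*⇒*↧≤∣↥∣* : ∀ p {m n} → fromℕ m ℚ.≤ p ℚ.* fromℕ n → m * ↧ₙ p ≤ ℤ.∣ ↥ p ∣ * n
fromℕ≤*⇒*↧≤∣↥∣* p@record{} {m} {n} m≤pn = begin
  m * ↧ₙ p                  ≡⟨ cong (m *_) (*-identityʳ (↧ₙ p)) ⟨
  m * (↧ₙ p * 1)            ≤⟨ +m≤i⇒m≤∣i∣ (subst₂ ℤ._≤_ (sym (ℤ.pos-* m _)) (ℤ.*-identityʳ (↥ p ℤ.* + n))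
                                (ℚᵘ.drop-*≤* unnormalised)) ⟩
  ℤ.∣ ↥ p ℤ.* + n ∣         ≡⟨ ℤ.abs-* (↥ p) (+ n) ⟩
  ℤ.∣ ↥ p ∣ * n             ∎
  where
  open ≤-Reasoning
  unnormalised : ℚᵘ.mkℚᵘ (+ m) 0 ℚᵘ.≤ ℚ.toℚᵘ p ℚᵘ.* ℚᵘ.mkℚᵘ (+ n) 0
  unnormalised = ℚᵘ.≤-respˡ-≃ (toℚᵘ-fromℕ m)
    (ℚᵘ.≤-respʳ-≃ (ℚᵘ.≃-trans (ℚ.toℚᵘ-homo-* p (fromℕ n))
                    (ℚᵘ.*-cong {ℚ.toℚᵘ p} ℚᵘ.≃-refl (toℚᵘ-fromℕ n)))
      (ℚ.toℚᵘ-mono-≤ m≤pn))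

All-concatMap-allFin : ∀ {A : Set} {P : ℕ → Set} (g : A → List ℕ) {K} (f : Fin K → A) →
                       (∀ i → All P (g (f i))) → All P (concatMap g (map f (allFin K)))
All-concatMap-allFin g f Pgf = All.concat⁺ (All.map⁺ (All.map⁺ (All.tabulate⁺ Pgf)))

-- Budget of nonpathological steps.

module _ (A : Implementation) where
  open Implementation A

  p q : ℕ
  p = ℤ.∣ ↥ α ∣
  q = ↧ₙ α

  -- α ^ d * m < 1 with denominators cleared.
  Budget : ℕ → ℕ → Set
  Budget d m = m * p ^ d < q ^ d

  budget-mono : ∀ d {m m′} → m′ ≤ m → Budget d m → Budget d m′
  budget-mono d m′≤m = ≤-<-trans (*-monoˡ-≤ (p ^ d) m′≤m)

  -- The step gives `m′ * q ≤ p * m`, which turns one factor `p` of the budget into a factor `q`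
  -- that cancels.
  budget-step : ∀ d {m m′} → fromℕ m′ ℚ.≤ α ℚ.* fromℕ m → Budget (suc d) m → Budget d m′
  budget-step d {m} {m′} m′≤αm b = *-cancelˡ-< q (m′ * p ^ d) (q ^ d) (begin-strict
    q * (m′ * p ^ d)   ≡⟨ reassoc q m′ (p ^ d) ⟩
    m′ * q * p ^ d     ≤⟨ *-monoˡ-≤ (p ^ d) (fromℕ≤*⇒*↧≤∣↥∣* α {m′} {m} m′≤αm) ⟩
    p * m * p ^ d      ≡⟨ reassoc′ p m (p ^ d) ⟩
    m * (p * p ^ d)    <⟨ b ⟩
    q * q ^ d          ∎)
    where
    open ≤-Reasoning
    reassoc : ∀ a b x → a * (b * x) ≡ b * a * x
    reassoc = solve-∀
    reassoc′ : ∀ a b x → a * b * x ≡ b * (a * x)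
    reassoc′ = solve-∀

  budget-log : ∀ n → Budget (q * suc ⌊log₂ n ⌋) n
  budget-log n = <-≤-trans
    -- Strictness survives the multiplication because `α` is positive, so that `p ^ d` is nonzero.
    (*-monoˡ-< (p ^ d) {{m^n≢0 p d {{∣↥p∣≢0 0<α}}}} (n<2^[1+⌊log₂n⌋] n))
    (2^l*p^ql≤q^ql (suc ⌊log₂ n ⌋) (∣↥p∣<↧p 0<α α<1))
    where d = q * suc ⌊log₂ n ⌋

  -- One frame and one offset vector of at most `suc Kmax` entries.
  levelWords : ℕ
  levelWords = frameWords + suc Kmax

  -- Space accounting along the recursion.

  module _ (Ch : Choices) where
    open Choices Ch
    open NFSSort A Ch
    open Execution

    -- The termination measure, taken at the budget instead of the size, bounds the number of
    -- further nested calls.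
    coreBound : (live d counter : ℕ) → ℕ
    coreBound live d counter = live + levelWords * (2 + measure d counter)

    -- The call's frame is already in `live`. Its vector is charged separately, as the initial call
    -- may have two more buckets. The level beyond the measure pays for the frame of a fallback
    -- sort.
    scatterBound : (live K d counter : ℕ) → ℕ
    scatterBound live K d counter = live + suc K + levelWords * suc (measure d counter)

    coreBound≤scatterBound : ∀ live K {d d′ counter counter′} →
      measure d′ counter′ < measure d counter →
      coreBound (live + suc K) d′ counter′ ≤ scatterBound live K d counter
    coreBound≤scatterBound live K lt =
      +-monoʳ-≤ (live + suc K) (*-monoʳ-≤ levelWords (s≤s lt))

    scatterBound≤coreBound : ∀ live {K} d counter → K ≤ Kmax →
      scatterBound (live + frameWords) K d counter ≤ coreBound live d counter
    scatterBound≤coreBound live {K} d counter K≤Kmax = begin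
      live + frameWords + suc K + rest      ≤⟨ +-monoˡ-≤ rest (+-monoʳ-≤ (live + frameWords) (s≤s K≤Kmax)) ⟩
      live + frameWords + suc Kmax + rest   ≡⟨ reassoc live frameWords (suc Kmax) (measure d counter) ⟩
      coreBound live d counter              ∎
      where
      open ≤-Reasoning
      rest = levelWords * suc (measure d counter)
      reassoc : ∀ l f x m → l + f + x + (f + x) * suc m ≡ l + (f + x) * (2 + m)
      reassoc = solve-∀

    frameWords≤ : ∀ m → frameWords ≤ levelWords * suc m
    frameWords≤ m = ≤-trans (m≤m+n frameWords (suc Kmax)) (m≤m*n levelWords (suc m))

    bucket : (L : Layout) → Array → Fin (Layout.K L) → Array
    bucket L xs = region (offsetVector K bucketOf ys) ys
      where
      open Layout L
      ys = proj₁ (permute bucketOf xs)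

    bucket-length : ∀ L xs i → length (bucket L xs i) ≤ length xs
    bucket-length L xs i =
      region-length (offsetVector K bucketOf (proj₁ permuted)) i (proj₁ (proj₂ permuted))
      where
      open Layout L
      permuted = permute bucketOf xs

    mutual
      -- Induction on the accessibility proof that drives the algorithm; the budget `d` is carried
      -- along independently of it.
      core-usage : ∀ live I counter xs rec d → Budget d (length xs) →
                   All (_≤ coreBound live d counter) (usage (core live I counter xs rec))
      core-usage live I counter xs rec d b with allPairs? ℚ._≟_ xs
      ... | yes _ = +-monoʳ-≤ live (frameWords≤ _) ∷ []
      ... | no  _ =
        All.map (λ u≤ → ≤-trans u≤ (scatterBound≤coreBound live d counter (k≤Kmax (length xs))))
          (scatterAndRecurse-usage (live + frameWords) (regular I (k (length xs))) counter xs rec d b)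

      -- All bucket calls start from the same live space, so one bound serves each of them and
      -- nothing is summed over siblings.
      scatterAndRecurse-usage : ∀ live L counter xs rec d → Budget d (length xs) →
        All (_≤ scatterBound live (Layout.K L) d counter)
            (usage (scatterAndRecurse live L counter xs rec))
      scatterAndRecurse-usage live L counter xs (acc rs) d b =
        m≤m+n _ _ ∷ All-concatMap-allFin usage _ (bucket-usage live L counter xs rs d b)

      -- The omitted list is the usage of the local procedure process of scatterAndRecurse,
      -- which cannot be named here; it is inferred from the use in scatterAndRecurse-usage.
      bucket-usage : ∀ live L counter xs
        (rs : ∀ {y} → y < measure (length xs) counter → Acc _<_ y) d → Budget d (length xs) →
        ∀ i → All (_≤ scatterBound live (Layout.K L) d counter) _
      bucket-usage live L counter xs rs d b i
        with action (length xs) counter (length (bucket L xs i))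
      ... | leave _ = []
      -- An exhausted budget forces `xs` to be empty, whereas this bucket has more than `S`
      -- elements.
      bucket-usage live L counter xs rs zero b i | recurse S<mᵢ _
        with () ← <-≤-trans (≤-<-trans z≤n (<-≤-trans S<mᵢ (bucket-length L xs i)))
                            (s≤s⁻¹ (subst (_< 1) (*-identityʳ _) b))
      -- One unit of budget pays for resetting the counter: the measure drops from `suc d` to `d`.
      bucket-usage live L counter xs rs (suc d) b i | recurse _ mᵢ≤αm =
        All.map (λ u≤ → ≤-trans u≤ (coreBound≤scatterBound live _ {suc d} {d} {counter} {0}
                                     (recurse-decreases {suc d} {d} counter ≤-refl)))
          (core-usage _ (Layout.bounds L (toℕ i)) 0 (bucket L xs i) _ d
            (budget-step d {length xs} {length (bucket L xs i)} mᵢ≤αm b))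
      -- The budget is kept, as the bucket is no longer than `xs`; the growing counter lowers the
      -- measure.
      ... | recurse⁺ _ _ counter<c =
        All.map (λ u≤ → ≤-trans u≤ (coreBound≤scatterBound live _ {d} {d} {counter} {suc counter}
                                     (recurse⁺-decreases {d} {d} {counter} ≤-refl counter<c)))
          (core-usage _ (Layout.bounds L (toℕ i)) (suc counter) (bucket L xs i) _ d
            (budget-mono d (bucket-length L xs i) b))
      ... | fall-back _ _ _ = +-monoʳ-≤ (live + suc (Layout.K L)) (frameWords≤ _) ∷ []

    initialK≤ : ∀ xs ib → Layout.K (initialLayout xs ib) ≤ 2 + Kmax
    initialK≤ xs (exact _ _ _)     = m≤n⇒m≤o+n 2 (k≤Kmax (length xs))
    initialK≤ xs (approximate _ _) = +-monoʳ-≤ 2 (k≤Kmax (length xs))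

    -- The last `frameWords` stands for the initial core call, and covers the final insertion sort
    -- as well.
    initialLive : ℕ
    initialLive = frameWords + workWords + frameWords

    nfsSort-usage : ∀ xs d → Budget d (length xs) →
                    All (_≤ scatterBound initialLive (2 + Kmax) d 0) (usage (nfsSort xs))
    nfsSort-usage xs d b with sorted? ℚ._≤?_ xs | sorted? ℚ._≤?_ (reverse xs)
    ... | yes _ | _     = ≤-trans (frameWords≤ _) (m≤n+m _ _) ∷ []
    ... | no  _ | yes _ = ≤-trans (frameWords≤ _) (m≤n+m _ _) ∷ []
    ... | no  _ | no  _ =
      ≤-trans (m≤m+n _ frameWords) live≤ ∷
      All.++⁺
        (All.map (λ u≤ → ≤-trans u≤ (+-monoˡ-≤ _ (+-monoʳ-≤ initialLive (s≤s (initialK≤ xs (initialBounds xs))))))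
          (scatterAndRecurse-usage initialLive (initialLayout xs (initialBounds xs)) 0 xs (<-wellFounded _) d b))
        (live≤ ∷ [])
      where
      live≤ : initialLive ≤ scatterBound initialLive (2 + Kmax) d 0
      live≤ = ≤-trans (m≤m+n initialLive _) (m≤m+n _ _)

-- The logarithmic bound.

-- For `l ≥ 1`, `a ≤ a * l` and `suc l ≤ l + l`.
affine≤linear : ∀ a b {l} → 1 ≤ l → a + b * suc l ≤ (a + (b + b)) * l
affine≤linear a b {suc l} _ = begin
  a + b * suc (suc l)                          ≤⟨ m≤m+n _ (a * l + b * l) ⟩
  a + b * suc (suc l) + (a * l + b * l)        ≡⟨ regroup a b l ⟩
  (a + (b + b)) * suc l                        ∎
  where
  open ≤-Reasoning
  regroup : ∀ a b l → a + b * suc (suc l) + (a * l + b * l) ≡ (a + (b + b)) * suc l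
  regroup = solve-∀

mainTheorem2 : (A : Implementation) → ∃[ C ] ∃[ n₀ ] ((n : ℕ) → n₀ ≤ n → (Ch : Choices) (xs : Array) → length xs ≡ n → spaceUsage A Ch xs ≤ C * ⌊log₂ n ⌋)
-- The threshold 2 makes `⌊log₂ n ⌋` at least 1, so that additive constants can be absorbed.
mainTheorem2 A = base + (slope + slope) , 2 , bound
  where
  open Implementation A
  open ≤-Reasoning
  -- `scatterBound` at `d = q * suc ⌊log₂ n ⌋` and counter 0 is affine in `suc ⌊log₂ n ⌋`; these are
  -- its coefficients.
  base slope : ℕ
  base  = frameWords + workWords + frameWords + suc (2 + Kmax) + levelWords A * suc c
  slope = levelWords A * (q A * suc c)

  regroup : ∀ z w q l c → z + w * suc (q * l * suc c + c) ≡ z + w * suc c + w * (q * suc c) * l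
  regroup = solve-∀

  bound : (n : ℕ) → 2 ≤ n → (Ch : Choices) (xs : Array) → length xs ≡ n →
          spaceUsage A Ch xs ≤ (base + (slope + slope)) * ⌊log₂ n ⌋
  bound n 2≤n Ch xs refl = begin
    spaceUsage A Ch xs
      ≤⟨ max≤v⁺ z≤n (nfsSort-usage A Ch xs d (budget-log A n)) ⟩
    scatterBound A Ch (initialLive A Ch) (2 + Kmax) d 0
      ≡⟨ regroup (initialLive A Ch + suc (2 + Kmax)) (levelWords A) (q A) (suc ⌊log₂ n ⌋) c ⟩
    base + slope * suc ⌊log₂ n ⌋
      ≤⟨ affine≤linear base slope (1≤⌊log₂n⌋ 2≤n) ⟩
    (base + (slope + slope)) * ⌊log₂ n ⌋ ∎
    where d = q A * suc ⌊log₂ n ⌋
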